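{- Let $\Gamma$ be an arbitrary directed graph on the node set $[k]$. Then a partition $E$ of $[k]$ is the equality partition of a face of the braid cone $Q(\Gamma,\mathbf 0)$ if and only if (i) for each part $K$ of $E$ the induced subgraph of $\Gamma$ on $K$ is weakly connected, and (ii) the minor of $\Gamma$ which results from simultaneously contracting each part of $E$ does not contain any directed cycle.
   Context: $[k]=\{1,\dots,k\}$. A directed graph $\Gamma$ on $[k]$ is identified with its set of arcs $(i,j)\in[k]\times[k]$. The braid cone of $\Gamma$ is $Q(\Gamma,\mathbf 0)=\{x\in\mathbb R^k : x_i\le x_j \text{ for all }(i,j)\in\Gamma\}$. Faces are the nonempty faces of this polyhedral cone, including the cone itself. The equality partition of a face $F$ is the partition of $[k]$ in which $i$ and $j$ lie in the same part if and only if $x_i=x_j$ for all $x\in F$. A directed graph is weakly connected if its underlying undirected graph is connected. In the contraction, the arcs having both endpoints in the same part are removed (they do not count as directed cycles). -}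

module Defs where

open import Data.Fin.Base using (Fin; zero; suc; inject₁; fromℕ)
open import Data.Fin.Subset as Subset using (Subset; Nonempty)
open import Data.List.Base using (List)
open import Data.List.Membership.Propositional as List using ()
open import Data.Nat.Base as ℕ using (ℕ; suc; _⊔_)
import Data.Nat.Properties as ℕ
open import Data.Product using (∃₂; ∃!; _×_; _,_; proj₁; proj₂; ∃-syntax)
open import Data.Rational.Base as ℚ using (ℚ; 0ℚ; 1ℚ; ½; ∣_∣)
import Data.Rational.Properties as ℚ
open import Data.Rational.Solver using (module +-*-Solver)
open import Data.Vec.Functional using (Vector; foldr; zipWith)
open import Function.Base using (_on_)
open import Function.Bundles using (_⇔_)
open import Function.Definitions using (Injective)
open import Level using (0ℓ)
open import Relation.Binary.Construct.Closure.Equivalence using (EqClosure)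
open import Relation.Binary.Core using (Rel)
open import Relation.Binary.PropositionalEquality
open import Relation.Unary using (Pred; Satisfiable; _∈_; _≐_)

-- Cauchy sequences of rationals, with _≈_ as equality.
record ℝ : Set where
  field
    seq    : ℕ → ℚ
    cauchy : ∀ {ε} → 0ℚ ℚ.< ε →
             ∃[ N ] ∀ {m n} → N ℕ.≤ m → N ℕ.≤ n → ∣ seq m ℚ.- seq n ∣ ℚ.< ε

open ℝ public

infix  4 _≈_ _≤_
infixl 6 _+_
infixl 7 _*_ _∙_

_≈_ : Rel ℝ 0ℓ
x ≈ y = ∀ {ε} → 0ℚ ℚ.< ε →
        ∃[ N ] ∀ {n} → N ℕ.≤ n → ∣ seq x n ℚ.- seq y n ∣ ℚ.< ε

_≤_ : Rel ℝ 0ℓ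
x ≤ y = ∀ {ε} → 0ℚ ℚ.< ε →
        ∃[ N ] ∀ {n} → N ℕ.≤ n → seq x n ℚ.- seq y n ℚ.< ε

0ℝ : ℝ
0ℝ .seq _      = 0ℚ
0ℝ .cauchy 0<ε = 0 , λ _ _ → 0<ε

private
  0<½*ε : ∀ {ε} → 0ℚ ℚ.< ε → 0ℚ ℚ.< ½ ℚ.* ε
  0<½*ε = ℚ.*-monoʳ-<-pos ½

  ½+½ : ∀ ε → ½ ℚ.* ε ℚ.+ ½ ℚ.* ε ≡ ε
  ½+½ ε = trans (sym (ℚ.*-distribʳ-+ ε ½ ½)) (ℚ.*-identityˡ ε)

_+_ : ℝ → ℝ → ℝ
(x + y) .seq n = seq x n ℚ.+ seq y n
(x + y) .cauchy {ε} 0<ε =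
  let M , x-close = cauchy x (0<½*ε 0<ε)
      N , y-close = cauchy y (0<½*ε 0<ε)
  in M ⊔ N , λ {m} {n} p q →
    let a = seq x m ; b = seq y m ; c = seq x n ; d = seq y n in
    begin-strict
      ∣ (a ℚ.+ b) ℚ.- (c ℚ.+ d) ∣
        ≡⟨ cong ∣_∣ (solve 4 (λ a b c d → (a :+ b) :- (c :+ d) := (a :- c) :+ (b :- d)) refl a b c d) ⟩
      ∣ (a ℚ.- c) ℚ.+ (b ℚ.- d) ∣
        ≤⟨ ℚ.∣p+q∣≤∣p∣+∣q∣ (a ℚ.- c) (b ℚ.- d) ⟩
      ∣ a ℚ.- c ∣ ℚ.+ ∣ b ℚ.- d ∣
        <⟨ ℚ.+-mono-< (x-close (ℕ.m⊔n≤o⇒m≤o M N p) (ℕ.m⊔n≤o⇒m≤o M N q))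
                      (y-close (ℕ.m⊔n≤o⇒n≤o M N p) (ℕ.m⊔n≤o⇒n≤o M N q)) ⟩
      ½ ℚ.* ε ℚ.+ ½ ℚ.* ε
        ≡⟨ ½+½ ε ⟩
      ε ∎
  where
  open ℚ.≤-Reasoning
  open +-*-Solver

private
  0<1 : 0ℚ ℚ.< 1ℚ
  0<1 = ℚ.positive⁻¹ 1ℚ

  eventually-bounded : ∀ x → ∃₂ λ B N → 0ℚ ℚ.< B × (∀ {n} → N ℕ.≤ n → ∣ seq x n ∣ ℚ.≤ B)
  eventually-bounded x = B , N , 0<B , bound
    where
    open ℚ.≤-Reasoning
    open +-*-Solver
    N = proj₁ (cauchy x 0<1)
    B = 1ℚ ℚ.+ ∣ seq x N ∣

    0<B : 0ℚ ℚ.< B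
    0<B = ℚ.+-mono-<-≤ 0<1 (ℚ.0≤∣p∣ (seq x N))

    bound : ∀ {n} → N ℕ.≤ n → ∣ seq x n ∣ ℚ.≤ B
    bound {n} p = let a = seq x n ; b = seq x N in begin
      ∣ a ∣                  ≡⟨ cong ∣_∣ (solve 2 (λ a b → a := (a :- b) :+ b) refl a b) ⟩
      ∣ (a ℚ.- b) ℚ.+ b ∣    ≤⟨ ℚ.∣p+q∣≤∣p∣+∣q∣ (a ℚ.- b) b ⟩
      ∣ a ℚ.- b ∣ ℚ.+ ∣ b ∣  ≤⟨ ℚ.+-monoˡ-≤ ∣ b ∣ (ℚ.<⇒≤ (proj₂ (cauchy x 0<1) p ℕ.≤-refl)) ⟩
      1ℚ ℚ.+ ∣ b ∣           ∎

  divide : ∀ {B ε} → 0ℚ ℚ.< B → 0ℚ ℚ.< ε → ∃[ η ] 0ℚ ℚ.< η × B ℚ.* η ≡ ε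
  divide {B} {ε} 0<B 0<ε = ℚ.1/ B ℚ.* ε , 0<η , (begin
    B ℚ.* (ℚ.1/ B ℚ.* ε)  ≡⟨ ℚ.*-assoc B (ℚ.1/ B) ε ⟨
    B ℚ.* ℚ.1/ B ℚ.* ε    ≡⟨ cong (ℚ._* ε) (ℚ.*-inverseʳ B) ⟩
    1ℚ ℚ.* ε              ≡⟨ ℚ.*-identityˡ ε ⟩
    ε                     ∎)
    where
    open ≡-Reasoning
    instance
      B>0 = ℚ.positive 0<B
      B≢0 = ℚ.pos⇒nonZero B
      1/B>0 = ℚ.1/pos⇒pos B
    0<η : 0ℚ ℚ.< ℚ.1/ B ℚ.* ε
    0<η = subst (ℚ._< ℚ.1/ B ℚ.* ε) (ℚ.*-zeroʳ (ℚ.1/ B)) (ℚ.*-monoʳ-<-pos (ℚ.1/ B) 0<ε)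

  ∣p*q∣≤B*η : ∀ {B η} p q → 0ℚ ℚ.< B → ∣ p ∣ ℚ.≤ B → ∣ q ∣ ℚ.< η → ∣ p ℚ.* q ∣ ℚ.< B ℚ.* η
  ∣p*q∣≤B*η {B} {η} p q 0<B p≤B q<η = begin-strict
    ∣ p ℚ.* q ∣      ≡⟨ ℚ.∣p*q∣≡∣p∣*∣q∣ p q ⟩
    ∣ p ∣ ℚ.* ∣ q ∣  ≤⟨ ℚ.*-monoʳ-≤-nonNeg ∣ q ∣ p≤B ⟩
    B ℚ.* ∣ q ∣      <⟨ ℚ.*-monoʳ-<-pos B q<η ⟩
    B ℚ.* η          ∎
    where
    open ℚ.≤-Reasoning
    instance
      B>0 = ℚ.positive 0<B
      q≥0 = ℚ.∣-∣-nonNeg q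

_*_ : ℝ → ℝ → ℝ
(x * y) .seq n = seq x n ℚ.* seq y n
(x * y) .cauchy {ε} 0<ε =
  let B , M , 0<B , x-bound = eventually-bounded x
      C , N , 0<C , y-bound = eventually-bounded y
      η , 0<η , C*η≡½*ε     = divide 0<C (0<½*ε 0<ε)
      θ , 0<θ , B*θ≡½*ε     = divide 0<B (0<½*ε 0<ε)
      M′ , x-close          = cauchy x 0<η
      N′ , y-close          = cauchy y 0<θ
      L                     = (M ⊔ M′) ⊔ (N ⊔ N′)
      M⊔M′≤ : ∀ {n} → L ℕ.≤ n → M ⊔ M′ ℕ.≤ n
      M⊔M′≤ = ℕ.m⊔n≤o⇒m≤o (M ⊔ M′) (N ⊔ N′)
      N⊔N′≤ : ∀ {n} → L ℕ.≤ n → N ⊔ N′ ℕ.≤ n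
      N⊔N′≤ = ℕ.m⊔n≤o⇒n≤o (M ⊔ M′) (N ⊔ N′)
  in L , λ {m} {n} p q →
    let a = seq x m ; b = seq y m ; c = seq x n ; d = seq y n in
    begin-strict
      ∣ a ℚ.* b ℚ.- c ℚ.* d ∣
        ≡⟨ cong ∣_∣ (solve 4 (λ a b c d → a :* b :- c :* d := a :* (b :- d) :+ d :* (a :- c)) refl a b c d) ⟩
      ∣ a ℚ.* (b ℚ.- d) ℚ.+ d ℚ.* (a ℚ.- c) ∣
        ≤⟨ ℚ.∣p+q∣≤∣p∣+∣q∣ (a ℚ.* (b ℚ.- d)) (d ℚ.* (a ℚ.- c)) ⟩
      ∣ a ℚ.* (b ℚ.- d) ∣ ℚ.+ ∣ d ℚ.* (a ℚ.- c) ∣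
        <⟨ ℚ.+-mono-<
             (∣p*q∣≤B*η a (b ℚ.- d) 0<B (x-bound (ℕ.m⊔n≤o⇒m≤o M M′ (M⊔M′≤ p)))
               (y-close (ℕ.m⊔n≤o⇒n≤o N N′ (N⊔N′≤ p)) (ℕ.m⊔n≤o⇒n≤o N N′ (N⊔N′≤ q))))
             (∣p*q∣≤B*η d (a ℚ.- c) 0<C (y-bound (ℕ.m⊔n≤o⇒m≤o N N′ (N⊔N′≤ q)))
               (x-close (ℕ.m⊔n≤o⇒n≤o M M′ (M⊔M′≤ p)) (ℕ.m⊔n≤o⇒n≤o M M′ (M⊔M′≤ q)))) ⟩
      B ℚ.* θ ℚ.+ C ℚ.* η
        ≡⟨ cong₂ ℚ._+_ B*θ≡½*ε C*η≡½*ε ⟩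
      ½ ℚ.* ε ℚ.+ ½ ℚ.* ε
        ≡⟨ ½+½ ε ⟩
      ε ∎
  where
  open ℚ.≤-Reasoning
  open +-*-Solver

_∙_ : ∀ {k} → Vector ℝ k → Vector ℝ k → ℝ
c ∙ x = foldr _+_ 0ℝ (zipWith _*_ c x)

-- A finite set of arcs is given by any list enumerating it; loops are
-- allowed.
Digraph : ℕ → Set
Digraph k = List (Fin k × Fin k)

Arc : ∀ {k} → Digraph k → Rel (Fin k) 0ℓ
Arc Γ i j = (i , j) List.∈ Γ

WeaklyConnected : {V : Set} → Rel V 0ℓ → Set
WeaklyConnected _⟶_ = ∀ u v → EqClosure _⟶_ u v

-- v₀ ⟶ v₁ ⟶ … ⟶ vₗ ⟶ v₀ with v₀, …, vₗ pairwise distinct.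
record DirectedCycle {V : Set} (_⟶_ : Rel V 0ℓ) : Set where
  field
    l        : ℕ
    vertex   : Vector V (suc l)
    distinct : Injective _≡_ _≡_ vertex
    step     : ∀ (i : Fin l) → vertex (inject₁ i) ⟶ vertex (suc i)
    close    : vertex (fromℕ l) ⟶ vertex zero

-- The parts are indexed by Fin size; being nonempty and disjoint, they
-- are automatically distinct.
record Partition (k : ℕ) : Set where
  field
    size     : ℕ
    part     : Fin size → Subset k
    nonempty : ∀ p → Nonempty (part p)
    covers   : ∀ i → ∃! _≡_ λ p → i Subset.∈ part p

open Partition public

SamePart : ∀ {k} → Partition k → Rel (Fin k) 0ℓ
SamePart E i j = ∃[ p ] i Subset.∈ part E p × j Subset.∈ part E p

InducedArc : ∀ {k} → Digraph k → (K : Subset k) → Rel (∃[ i ] i Subset.∈ K) 0ℓ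
InducedArc Γ K = Arc Γ on proj₁

-- The vertices of the minor are the parts.  Parallel arcs are irrelevant
-- for directed cycles and are identified.
MinorArc : ∀ {k} → Digraph k → (E : Partition k) → Rel (Fin (size E)) 0ℓ
MinorArc Γ E p q =
  p ≢ q × ∃₂ λ i j → i Subset.∈ part E p × j Subset.∈ part E q × Arc Γ i j

braidCone : ∀ {k} → Digraph k → Pred (Vector ℝ k) 0ℓ
braidCone Γ x = ∀ {i j} → Arc Γ i j → x i ≤ x j

-- Nonempty faces: the sets where an inequality c ∙ x ≤ δ valid on Q is
-- attained with equality.  Taking c and δ to be zero gives Q itself.
IsFace : ∀ {k} → Pred (Vector ℝ k) 0ℓ → Pred (Vector ℝ k) 0ℓ → Set
IsFace {k} Q F =
  Satisfiable F ×
  ∃₂ λ (c : Vector ℝ k) (δ : ℝ) →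
    (∀ x → x ∈ Q → c ∙ x ≤ δ) ×
    F ≐ (λ x → x ∈ Q × c ∙ x ≈ δ)

IsEqualityPartition : ∀ {k} → Partition k → Pred (Vector ℝ k) 0ℓ → Set
IsEqualityPartition E F =
  ∀ i j → SamePart E i j ⇔ (∀ x → x ∈ F → x i ≈ x j)

{-# OPTIONS --safe #-}

-- For a part K of the equality partition of a face F, let C ⊆ K be a weak
-- component.  A sum of points of F, one for each arc joining two parts, has
-- some slack η > 0 on all those arcs, so moving it by ± η along the indicator
-- of C stays in the cone.  The functional defining F attains its maximum at
-- the midpoint of the two moved points, hence these lie in F, which forces
-- C = K.  Only finitely many instances of excluded middle are needed, and they
-- are harmless because connectivity of a finite graph is decidable.
--
-- Conversely, F is cut out by Σ (xᵢ - xⱼ) over the arcs inside the parts.  If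
-- p and q are distinct parts then, by acyclicity, one of them, say q, is not
-- reachable from the other, and the indicator of the vertices reachable from p
-- is a point of F which separates p from q.
module Submission where

open import Defs
open import Data.Bool.Base using (Bool; true; false; if_then_else_)
open import Data.Empty using (⊥-elim)
open import Data.Fin.Base using (Fin; zero; suc; inject₁; fromℕ)
import Data.Fin.Properties as Fin
import Data.Fin.Subset as Subset
open import Data.Fin.Subset.Properties using () renaming (_∈?_ to _∈ˢ?_)
open import Data.List.Base using (List; []; _∷_; filter; cartesianProduct; allFin)
import Data.List.Membership.DecPropositional as DecMembership
open import Data.List.Membership.Propositional using () renaming (_∈_ to _∈ˡ_)
open import Data.List.Membership.Propositional.Properties
  using (∈-filter⁺; ∈-filter⁻; ∈-cartesianProduct⁺; ∈-allFin)
open import Data.List.Relation.Unary.Any using (here; there)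
open import Data.Nat.Base as ℕ using (ℕ; zero; suc; _⊔_)
import Data.Nat.Properties as ℕ
open import Data.Product using (∃-syntax; _×_; _,_; proj₁; proj₂; uncurry)
open import Data.Product.Properties using (≡-dec)
open import Data.Rational.Base as ℚ using (ℚ; 0ℚ; 1ℚ; ½; ∣_∣)
import Data.Rational.Properties as ℚ
open import Data.Rational.Solver using (module +-*-Solver)
open import Data.Sum.Base using (_⊎_; inj₁; inj₂)
open import Data.Vec.Functional as Vector using (Vector; updateAt; tail)
open import Data.Vec.Properties.WithK using ([]=-irrelevant)
open import Function.Base using (id; _∘_)
open import Function.Bundles using (_⇔_; mk⇔; Equivalence)
open import Function.Definitions using (Injective)
open import Level using (0ℓ)
open import Relation.Binary.Construct.Closure.Equivalence as EqClosure using (EqClosure)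
open import Relation.Binary.Construct.Closure.ReflexiveTransitive as Star
  using (Star; ε; _◅_; _◅◅_)
open import Relation.Binary.Construct.Closure.Symmetric using (SymClosure; fwd; bwd)
open import Relation.Binary.Core using (Rel; _⇒_)
open import Relation.Binary.Definitions using (Decidable; DecidableEquality)
open import Relation.Binary.PropositionalEquality
open import Relation.Binary.Structures using (IsEquivalence)
open import Relation.Nullary.Decidable
  using (Dec; yes; no; does; map′; _×-dec_; _⊎-dec_; ¬?; dec-true; dec-false; does-⇔)
open import Relation.Nullary.Negation using (¬_; contradiction)
open import Relation.Unary using (Pred; Satisfiable; _∈_; _≐_)

-- Finite relations

module _ {V : Set} (_≟_ : DecidableEquality V) where

  -- Recursion on the arcs. A walk using the new arc from `a` to `b` can be cut down to its prefix
  -- before the first use and its suffix after the last use, so one passage through the arc is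
  -- enough.
  star-dec : (Δ : List (V × V)) → Decidable (Star (λ u v → (u , v) ∈ˡ Δ))
  star-dec [] u v = map′ (λ { refl → ε }) (λ { ε → refl ; (() ◅ _) }) (u ≟ v)
  star-dec ((a , b) ∷ Δ) u v =
    map′ extend shorten
      (star-dec Δ u v ⊎-dec (star-dec Δ u a ×-dec star-dec Δ b v))
    where
    Old New : Rel V 0ℓ
    Old = Star (λ u v → (u , v) ∈ˡ Δ)
    New = Star (λ u v → (u , v) ∈ˡ ((a , b) ∷ Δ))

    extend : ∀ {u v} → Old u v ⊎ (Old u a × Old b v) → New u v
    extend (inj₁ uv)        = Star.map there uv
    extend (inj₂ (ua , bv)) = Star.map there ua ◅◅ here refl ◅ Star.map there bv

    shorten : ∀ {u v} → New u v → Old u v ⊎ (Old u a × Old b v)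
    shorten ε = inj₁ ε
    shorten (here refl ◅ s) with shorten s
    ... | inj₁ bv       = inj₂ (ε , bv)
    ... | inj₂ (_ , bv) = inj₂ (ε , bv)
    shorten (there r ◅ s) with shorten s
    ... | inj₁ wv        = inj₁ (r ◅ wv)
    ... | inj₂ (wa , bv) = inj₂ (r ◅ wa , bv)

star? : ∀ {n} {R : Rel (Fin n) 0ℓ} → Decidable R → Decidable (Star R)
star? {n} {R} R? u v = map′ (Star.map sound) (Star.map complete) (star-dec Fin._≟_ arcs u v)
  where
  arcs = filter (uncurry R?) (cartesianProduct (allFin n) (allFin n))
  sound : ∀ {i j} → (i , j) ∈ˡ arcs → R i j
  sound = proj₂ ∘ ∈-filter⁻ (uncurry R?) {xs = cartesianProduct (allFin n) (allFin n)}
  complete : ∀ {i j} → R i j → (i , j) ∈ˡ arcs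
  complete = ∈-filter⁺ (uncurry R?) (∈-cartesianProduct⁺ (∈-allFin _) (∈-allFin _))

symClosure? : ∀ {V : Set} {R : Rel V 0ℓ} → Decidable R → Decidable (SymClosure R)
symClosure? R? u v =
  map′ (λ { (inj₁ r) → fwd r ; (inj₂ r) → bwd r })
       (λ { (fwd r) → inj₁ r ; (bwd r) → inj₂ r })
       (R? u v ⊎-dec R? v u)

-- Simple paths and directed cycles

record SimplePath {V : Set} (R : Rel V 0ℓ) (u v : V) : Set where
  field
    l        : ℕ
    vertex   : Vector V (suc l)
    distinct : Injective _≡_ _≡_ vertex
    step     : ∀ (i : Fin l) → R (vertex (inject₁ i)) (vertex (suc i))
    source   : vertex zero ≡ u
    target   : vertex (fromℕ l) ≡ v

module _ {V : Set} {R : Rel V 0ℓ} where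

  open SimplePath

  nil : ∀ u → SimplePath R u u
  nil u .l                        = 0
  nil u .vertex _                 = u
  nil u .distinct {zero} {zero} _ = refl
  nil u .step ()
  nil u .source                   = refl
  nil u .target                   = refl

  cons : ∀ {u w v} → R u w → (π : SimplePath R w v) → (∀ i → u ≢ vertex π i) → SimplePath R u v
  cons r π u∉π .l                              = suc (l π)
  cons {u} r π u∉π .vertex                     = u Vector.∷ vertex π
  cons r π u∉π .distinct {zero}  {zero}  _     = refl
  cons r π u∉π .distinct {zero}  {suc j} eq    = contradiction eq (u∉π j)
  cons r π u∉π .distinct {suc i} {zero}  eq    = contradiction (sym eq) (u∉π i)
  cons r π u∉π .distinct {suc i} {suc j} eq    = cong suc (distinct π eq)
  cons {u} r π u∉π .step zero                  = subst (R u) (sym (source π)) r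
  cons r π u∉π .step (suc i)                   = step π i
  cons r π u∉π .source                         = refl
  cons r π u∉π .target                         = target π

  suffix : ∀ {u v} (π : SimplePath R u v) (i : Fin (suc (l π))) → SimplePath R (vertex π i) v
  suffix {v = v} record { l = l ; vertex = x ; distinct = d ; step = s ; target = t } = from x d s t
    where
    -- The recursion drops the first vertex each time, so length and vertices must vary. The source
    -- equation is left behind because the suffix starts at `x i` by definition.
    from : ∀ {l} (x : Vector V (suc l)) → Injective _≡_ _≡_ x →
           (∀ (i : Fin l) → R (x (inject₁ i)) (x (suc i))) → x (fromℕ l) ≡ v →
           ∀ i → SimplePath R (x i) v
    from x d s t zero = record
      { vertex = x ; distinct = d ; step = s ; source = refl ; target = t }
    from {suc l} x d s t (suc i) = from (tail x) (Fin.suc-injective ∘ d) (s ∘ suc) t i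

  -- Loop erasure from the far end: if `u` already lies on the simple path built for the rest of the
  -- walk, only the suffix from that occurrence is kept; otherwise `u` is prepended.
  simplePath : DecidableEquality V → ∀ {u v} → Star R u v → SimplePath R u v
  simplePath _≟_ ε = nil _
  simplePath _≟_ {u} (r ◅ s) with simplePath _≟_ s
  ... | π with Fin.any? (λ i → u ≟ vertex π i)
  ...   | yes (i , refl) = suffix π i
  ...   | no u∉π         = cons r π (λ i eq → u∉π (i , eq))

  -- The first arc of the walk from `u` to `v`, which exists because `u ≢ v`, becomes the closing
  -- arc. The rest of that walk followed by `vu` leads back to `u` and is made simple.
  star⇒cycle : DecidableEquality V → ∀ {u v} → u ≢ v → Star R u v → Star R v u → DirectedCycle R
  star⇒cycle _≟_ u≢v ε       vu = contradiction refl u≢v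
  star⇒cycle _≟_ u≢v (r ◅ s) vu = record
    { l        = l π
    ; vertex   = vertex π
    ; distinct = distinct π
    ; step     = step π
    ; close    = subst₂ R (sym (target π)) (sym (source π)) r
    }
    where π = simplePath _≟_ (s ◅◅ vu)

-- Real numbers

const : ℚ → ℝ
const q .seq _          = q
const q .cauchy {δ} 0<δ = 0 , λ _ _ → subst (λ d → ∣ d ∣ ℚ.< δ) (sym (ℚ.+-inverseʳ q)) 0<δ

0<½*_ : ∀ {δ} → 0ℚ ℚ.< δ → 0ℚ ℚ.< ½ ℚ.* δ
0<½*_ = ℚ.*-monoʳ-<-pos ½

½+½ : ∀ δ → ½ ℚ.* δ ℚ.+ ½ ℚ.* δ ≡ δ
½+½ δ = trans (sym (ℚ.*-distribʳ-+ δ ½ ½)) (ℚ.*-identityˡ δ)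

p≤∣p∣ : ∀ p → p ℚ.≤ ∣ p ∣
p≤∣p∣ p with ℚ.≤-total 0ℚ p
... | inj₁ 0≤p = ℚ.≤-reflexive (sym (ℚ.0≤p⇒∣p∣≡p 0≤p))
... | inj₂ p≤0 = ℚ.≤-trans p≤0 (ℚ.0≤∣p∣ p)

∣p-q∣<r⇒p<q+r : ∀ p q {r} → ∣ p ℚ.- q ∣ ℚ.< r → p ℚ.< q ℚ.+ r
∣p-q∣<r⇒p<q+r p q {r} d<r = begin-strict
  p                    ≡⟨ solve 2 (λ p q → p := q :+ (p :- q)) refl p q ⟩
  q ℚ.+ (p ℚ.- q)      ≤⟨ ℚ.+-monoʳ-≤ q (p≤∣p∣ (p ℚ.- q)) ⟩
  q ℚ.+ ∣ p ℚ.- q ∣    <⟨ ℚ.+-monoʳ-< q d<r ⟩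
  q ℚ.+ r              ∎
  where
  open ℚ.≤-Reasoning
  open +-*-Solver

p≤q⇒p-q≤0 : ∀ {p q} → p ℚ.≤ q → p ℚ.- q ℚ.≤ 0ℚ
p≤q⇒p-q≤0 {p} {q} p≤q = subst (p ℚ.- q ℚ.≤_) (ℚ.+-inverseʳ q) (ℚ.+-monoˡ-≤ (ℚ.- q) p≤q)

-- _≤_ and _≈_ unfold to function types, from which their arguments cannot be
-- inferred; the wrapper keeps the endpoints visible to the unifier.
infix 4 _≼_
record _≼_ (x y : ℝ) : Set where
  constructor ⌈_⌉
  field ⌊_⌋ : x ≤ y
open _≼_

≼-eventually : ∀ {x y} N → (∀ {n} → N ℕ.≤ n → seq x n ℚ.≤ seq y n) → x ≼ y
≼-eventually N x≤y = ⌈ (λ 0<δ → N , λ N≤n → ℚ.≤-<-trans (p≤q⇒p-q≤0 (x≤y N≤n)) 0<δ) ⌉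

≼-pointwise : ∀ {x y} → (∀ n → seq x n ℚ.≤ seq y n) → x ≼ y
≼-pointwise x≤y = ≼-eventually 0 (λ {n} _ → x≤y n)

≼-refl : ∀ {x} → x ≼ x
≼-refl = ≼-pointwise (λ _ → ℚ.≤-refl)

-- Every consequence of two inequalities below is linear, so it amounts to an
-- identity between the differences of the two sides.
≼-add : ∀ {a b c d x y} → a ≼ b → c ≼ d →
        (∀ n → seq x n ℚ.- seq y n ≡ (seq a n ℚ.- seq b n) ℚ.+ (seq c n ℚ.- seq d n)) →
        x ≼ y
≼-add ⌈ a≤b ⌉ ⌈ c≤d ⌉ eq = ⌈ (λ {δ} 0<δ →
  let M , a<b = a≤b (0<½* 0<δ)
      N , c<d = c≤d (0<½* 0<δ)
  in M ⊔ N , λ {n} p →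
    subst₂ ℚ._<_ (sym (eq n)) (½+½ δ)
      (ℚ.+-mono-< (a<b (ℕ.m⊔n≤o⇒m≤o M N p)) (c<d (ℕ.m⊔n≤o⇒n≤o M N p)))) ⌉

≼-trans : ∀ {x y z} → x ≼ y → y ≼ z → x ≼ z
≼-trans {x} {y} {z} x≼y y≼z = ≼-add x≼y y≼z λ n →
  solve 3 (λ x y z → x :- z := (x :- y) :+ (y :- z)) refl (seq x n) (seq y n) (seq z n)
  where open +-*-Solver

-[p-q]≡q-p : ∀ p q → ℚ.- (p ℚ.- q) ≡ q ℚ.- p
-[p-q]≡q-p = solve 2 (λ p q → :- (p :- q) := q :- p) refl
  where open +-*-Solver

≈⇒≼ : ∀ {x y} → x ≈ y → x ≼ y
≈⇒≼ {x} {y} x≈y = ⌈ (λ 0<δ →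
  let N , x-y = x≈y 0<δ
  in N , λ {n} p → ℚ.≤-<-trans (p≤∣p∣ (seq x n ℚ.- seq y n)) (x-y p)) ⌉

≈⇒≽ : ∀ {x y} → x ≈ y → y ≼ x
≈⇒≽ {x} {y} x≈y = ⌈ (λ {δ} 0<δ →
  let N , x-y = x≈y 0<δ
  in N , λ {n} p → ℚ.≤-<-trans
       (ℚ.≤-trans (p≤∣p∣ (seq y n ℚ.- seq x n)) (ℚ.≤-reflexive (flip (seq y n) (seq x n)))) (x-y p)) ⌉
  where
  flip : ∀ p q → ∣ p ℚ.- q ∣ ≡ ∣ q ℚ.- p ∣
  flip p q = trans (sym (ℚ.∣-p∣≡∣p∣ (p ℚ.- q))) (cong ∣_∣ (-[p-q]≡q-p p q))

≼-antisym : ∀ {x y} → x ≼ y → y ≼ x → x ≈ y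
≼-antisym {x} {y} ⌈ x≤y ⌉ ⌈ y≤x ⌉ {δ} 0<δ =
  let M , x<y = x≤y 0<δ
      N , y<x = y≤x 0<δ
  in M ⊔ N , λ {n} p → abs (seq x n) (seq y n)
       (x<y (ℕ.m⊔n≤o⇒m≤o M N p)) (y<x (ℕ.m⊔n≤o⇒n≤o M N p))
  where
  abs : ∀ p q → p ℚ.- q ℚ.< δ → q ℚ.- p ℚ.< δ → ∣ p ℚ.- q ∣ ℚ.< δ
  abs p q p<q q<p with ℚ.∣p∣≡p∨∣p∣≡-p (p ℚ.- q)
  ... | inj₁ eq = subst (ℚ._< δ) (sym eq) p<q
  ... | inj₂ eq = subst (ℚ._< δ) (sym (trans eq (-[p-q]≡q-p p q))) q<p

const-mono : ∀ {p q} → p ℚ.≤ q → const p ≼ const q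
const-mono p≤q = ≼-pointwise (λ _ → p≤q)

const-¬≼ : ∀ {p q} → p ℚ.< q → ¬ (const q ≼ const p)
const-¬≼ {p} {q} p<q ⌈ q≤p ⌉ =
  let N , q-p<q-p = q≤p (subst (ℚ._< q ℚ.- p) (ℚ.+-inverseʳ p) (ℚ.+-monoˡ-< (ℚ.- p) p<q))
  in ℚ.<-irrefl refl (q-p<q-p ℕ.≤-refl)

-- The constructive substitute for comparing two reals.
≲-or-gap : ∀ x y {δ} → 0ℚ ℚ.< δ →
           (∃[ N ] ∀ {n} → N ℕ.≤ n → seq x n ℚ.- seq y n ℚ.< δ) ⊎
           (∃[ η ] 0ℚ ℚ.< η × y + const η ≼ x)
≲-or-gap x y {δ} 0<δ = compare (d N ℚ.<? θ)
  where
  open ℚ.≤-Reasoning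
  open +-*-Solver
  -- With `z` the difference of `x` and `y`, values of `d` from `N` on vary by less than `κ`, a
  -- quarter of `δ`. The rational test of `d N` against `θ` thus gives either `d n` below `δ` or
  -- `d n` at least `θ` minus `κ`, which is `κ`.
  θ = ½ ℚ.* δ
  κ = ½ ℚ.* θ
  0<κ : 0ℚ ℚ.< κ
  0<κ = 0<½* (0<½* 0<δ)
  z = x + const (ℚ.- 1ℚ) * y
  d = seq z
  N = proj₁ (cauchy z 0<κ)
  close : ∀ {m n} → N ℕ.≤ m → N ℕ.≤ n → d m ℚ.< d n ℚ.+ κ
  close {m} {n} p q = ∣p-q∣<r⇒p<q+r (d m) (d n) (proj₂ (cauchy z 0<κ) p q)
  diff : ∀ n → seq x n ℚ.- seq y n ≡ d n
  diff n = solve 2 (λ x y → x :- y := x :+ (:- con 1ℚ) :* y) refl (seq x n) (seq y n)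
  κ≤θ : κ ℚ.≤ θ
  κ≤θ = begin
    κ          ≡⟨ ℚ.+-identityʳ κ ⟨
    κ ℚ.+ 0ℚ   ≤⟨ ℚ.+-monoʳ-≤ κ (ℚ.<⇒≤ 0<κ) ⟩
    κ ℚ.+ κ    ≡⟨ ½+½ θ ⟩
    θ          ∎
  compare : Dec (d N ℚ.< θ) → _
  compare (yes d<θ) = inj₁ (N , λ {n} p → begin-strict
    seq x n ℚ.- seq y n  ≡⟨ diff n ⟩
    d n                  <⟨ close p ℕ.≤-refl ⟩
    d N ℚ.+ κ            <⟨ ℚ.+-mono-<-≤ d<θ κ≤θ ⟩
    θ ℚ.+ θ              ≡⟨ ½+½ δ ⟩
    δ                    ∎)
  compare (no d≮θ) = inj₂ (κ , 0<κ , ≼-eventually N λ {n} p → begin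
    seq y n ℚ.+ κ                          ≡⟨ solve 2 (λ y κ → y :+ κ := y :+ ((κ :+ κ) :- κ)) refl (seq y n) κ ⟩
    seq y n ℚ.+ ((κ ℚ.+ κ) ℚ.- κ)          ≡⟨ cong (λ t → seq y n ℚ.+ (t ℚ.- κ)) (½+½ θ) ⟩
    seq y n ℚ.+ (θ ℚ.- κ)                  ≤⟨ ℚ.+-monoʳ-≤ (seq y n) (ℚ.+-monoˡ-≤ (ℚ.- κ) (ℚ.≮⇒≥ d≮θ)) ⟩
    seq y n ℚ.+ (d N ℚ.- κ)                ≤⟨ ℚ.+-monoʳ-≤ (seq y n) (ℚ.+-monoˡ-≤ (ℚ.- κ) (ℚ.<⇒≤ (close ℕ.≤-refl p))) ⟩
    seq y n ℚ.+ ((d n ℚ.+ κ) ℚ.- κ)        ≡⟨ solve 3 (λ x y κ → y :+ (((x :+ (:- con 1ℚ) :* y) :+ κ) :- κ) := x) refl (seq x n) (seq y n) κ ⟩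
    seq x n                                ∎)

-- An inequality of reals is a family of approximate statements, one for each `δ`. `≲-or-gap` proves
-- each of them once gaps are excluded, so no excluded middle enters.
¬gap⇒≼ : ∀ {x y} → ¬ (∃[ η ] 0ℚ ℚ.< η × y + const η ≼ x) → x ≼ y
¬gap⇒≼ {x} {y} ¬gap = ⌈ (λ {δ} 0<δ → approx (≲-or-gap x y 0<δ)) ⌉
  where
  approx : ∀ {A : Set} → A ⊎ _ → A
  approx (inj₁ a)   = a
  approx (inj₂ gap) = contradiction gap ¬gap

-- Linear functionals

0ᵛ : ∀ {k} → Vector ℝ k
0ᵛ _ = 0ℝ

constᵛ : ∀ {k} → Vector ℚ k → Vector ℝ k
constᵛ t i = const (t i)

infixl 6 _+ᵛ_
_+ᵛ_ : ∀ {k} → Vector ℝ k → Vector ℝ k → Vector ℝ k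
(x +ᵛ y) i = x i + y i

-- Pointwise in n, a linear functional on ℝᵏ is a rational dot product.
infixl 7 _·_
_·_ : ∀ {k} → Vector ℚ k → Vector ℚ k → ℚ
c · x = Vector.foldr ℚ._+_ 0ℚ (Vector.zipWith ℚ._*_ c x)

seq-foldr : ∀ {k} (x : Vector ℝ k) n →
            seq (Vector.foldr _+_ 0ℝ x) n ≡ Vector.foldr ℚ._+_ 0ℚ (λ i → seq (x i) n)
seq-foldr {zero}  x n = refl
seq-foldr {suc k} x n = cong (seq (x zero) n ℚ.+_) (seq-foldr (tail x) n)

seq-∙ : ∀ {k} (c x : Vector ℝ k) n → seq (c ∙ x) n ≡ (λ i → seq (c i) n) · (λ i → seq (x i) n)
seq-∙ c x n = seq-foldr (Vector.zipWith _*_ c x) n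

·-zeroʳ : ∀ {k} (c : Vector ℚ k) → c · (λ _ → 0ℚ) ≡ 0ℚ
·-zeroʳ {zero}  c = refl
·-zeroʳ {suc k} c =
  trans (cong₂ ℚ._+_ (ℚ.*-zeroʳ (c zero)) (·-zeroʳ (tail c))) (ℚ.+-identityˡ 0ℚ)

·-zeroˡ : ∀ {k} (x : Vector ℚ k) → (λ _ → 0ℚ) · x ≡ 0ℚ
·-zeroˡ {zero}  x = refl
·-zeroˡ {suc k} x =
  trans (cong₂ ℚ._+_ (ℚ.*-zeroˡ (x zero)) (·-zeroˡ (tail x))) (ℚ.+-identityˡ 0ℚ)

-- Stated for two equal sums so as to cover both additivity, where `b` vanishes, and the midpoint
-- identity used in `perturb`.
·-balance : ∀ {k} (c a b x y : Vector ℚ k) → (∀ i → a i ℚ.+ b i ≡ x i ℚ.+ y i) →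
            c · a ℚ.+ c · b ≡ c · x ℚ.+ c · y
·-balance {zero}  c a b x y eq = refl
·-balance {suc k} c a b x y eq = begin
  c · a ℚ.+ c · b
    ≡⟨ regroup (c zero) (a zero) (b zero) _ _ ⟩
  c zero ℚ.* (a zero ℚ.+ b zero) ℚ.+ (tail c · tail a ℚ.+ tail c · tail b)
    ≡⟨ cong₂ (λ s t → c zero ℚ.* s ℚ.+ t) (eq zero)
         (·-balance (tail c) (tail a) (tail b) (tail x) (tail y) (λ i → eq (suc i))) ⟩
  c zero ℚ.* (x zero ℚ.+ y zero) ℚ.+ (tail c · tail x ℚ.+ tail c · tail y)
    ≡⟨ regroup (c zero) (x zero) (y zero) _ _ ⟨
  c · x ℚ.+ c · y ∎
  where
  open ≡-Reasoning
  open +-*-Solver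
  regroup : ∀ c a b A B → c ℚ.* a ℚ.+ A ℚ.+ (c ℚ.* b ℚ.+ B) ≡ c ℚ.* (a ℚ.+ b) ℚ.+ (A ℚ.+ B)
  regroup = solve 5 (λ c a b A B → c :* a :+ A :+ (c :* b :+ B) := c :* (a :+ b) :+ (A :+ B)) refl

·-updateAt : ∀ {k} (c x : Vector ℚ k) i q → updateAt c i (q ℚ.+_) · x ≡ q ℚ.* x i ℚ.+ c · x
·-updateAt {suc k} c x zero q =
  solve 4 (λ q c x D → (q :+ c) :* x :+ D := q :* x :+ (c :* x :+ D)) refl
    q (c zero) (x zero) (tail c · tail x)
  where open +-*-Solver
·-updateAt {suc k} c x (suc i) q =
  trans (cong (c zero ℚ.* x zero ℚ.+_) (·-updateAt (tail c) (tail x) i q))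
    (solve 3 (λ e u D → e :+ (u :+ D) := u :+ (e :+ D)) refl
      (c zero ℚ.* x zero) (q ℚ.* x (suc i)) (tail c · tail x))
  where open +-*-Solver

∙-zeroʳ : ∀ {k} (c : Vector ℝ k) n → seq (c ∙ 0ᵛ) n ≡ 0ℚ
∙-zeroʳ c n = trans (seq-∙ c 0ᵛ n) (·-zeroʳ (λ i → seq (c i) n))

∙-balance : ∀ {k} (c a b x y : Vector ℝ k) n →
            (∀ i → seq (a i) n ℚ.+ seq (b i) n ≡ seq (x i) n ℚ.+ seq (y i) n) →
            seq (c ∙ a) n ℚ.+ seq (c ∙ b) n ≡ seq (c ∙ x) n ℚ.+ seq (c ∙ y) n
∙-balance c a b x y n eq = begin
  seq (c ∙ a) n ℚ.+ seq (c ∙ b) n  ≡⟨ cong₂ ℚ._+_ (seq-∙ c a n) (seq-∙ c b n) ⟩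
  at c · at a ℚ.+ at c · at b      ≡⟨ ·-balance (at c) (at a) (at b) (at x) (at y) eq ⟩
  at c · at x ℚ.+ at c · at y      ≡⟨ cong₂ ℚ._+_ (seq-∙ c x n) (seq-∙ c y n) ⟨
  seq (c ∙ x) n ℚ.+ seq (c ∙ y) n  ∎
  where
  open ≡-Reasoning
  at : ∀ {k} → Vector ℝ k → Vector ℚ k
  at x i = seq (x i) n

∙-distribˡ-+ᵛ : ∀ {k} (c x y : Vector ℝ k) n →
                seq (c ∙ (x +ᵛ y)) n ≡ seq (c ∙ x) n ℚ.+ seq (c ∙ y) n
∙-distribˡ-+ᵛ c x y n = begin
  seq (c ∙ (x +ᵛ y)) n                     ≡⟨ ℚ.+-identityʳ _ ⟨
  seq (c ∙ (x +ᵛ y)) n ℚ.+ 0ℚ              ≡⟨ cong (seq (c ∙ (x +ᵛ y)) n ℚ.+_) (∙-zeroʳ c n) ⟨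
  seq (c ∙ (x +ᵛ y)) n ℚ.+ seq (c ∙ 0ᵛ) n  ≡⟨ ∙-balance c (x +ᵛ y) 0ᵛ x y n (λ i → ℚ.+-identityʳ _) ⟩
  seq (c ∙ x) n ℚ.+ seq (c ∙ y) n          ∎
  where open ≡-Reasoning

-- Coefficients of the functional summing `x i` minus `x j` over the listed arcs. Entries are added
-- to, not overwritten, so repeated arcs count with multiplicity and loops contribute zero.
normalℚ : ∀ {k} → Digraph k → Vector ℚ k
normalℚ []            _ = 0ℚ
normalℚ ((i , j) ∷ Δ)   = updateAt (updateAt (normalℚ Δ) j (ℚ.- 1ℚ ℚ.+_)) i (1ℚ ℚ.+_)

normal : ∀ {k} → Digraph k → Vector ℝ k
normal Δ i = const (normalℚ Δ i)

normal-[] : ∀ {k} (x : Vector ℝ k) n → seq (normal [] ∙ x) n ≡ 0ℚ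
normal-[] x n = trans (seq-∙ (normal []) x n) (·-zeroˡ (λ i → seq (x i) n))

normal-∷ : ∀ {k} i j (Δ : Digraph k) x n →
           seq (normal ((i , j) ∷ Δ) ∙ x) n ≡ (seq (x i) n ℚ.- seq (x j) n) ℚ.+ seq (normal Δ ∙ x) n
normal-∷ i j Δ x n = begin
  seq (normal ((i , j) ∷ Δ) ∙ x) n
    ≡⟨ seq-∙ (normal ((i , j) ∷ Δ)) x n ⟩
  normalℚ ((i , j) ∷ Δ) · xₙ
    ≡⟨ ·-updateAt (updateAt (normalℚ Δ) j (ℚ.- 1ℚ ℚ.+_)) xₙ i 1ℚ ⟩
  1ℚ ℚ.* xₙ i ℚ.+ updateAt (normalℚ Δ) j (ℚ.- 1ℚ ℚ.+_) · xₙ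
    ≡⟨ cong (1ℚ ℚ.* xₙ i ℚ.+_) (·-updateAt (normalℚ Δ) xₙ j (ℚ.- 1ℚ)) ⟩
  1ℚ ℚ.* xₙ i ℚ.+ (ℚ.- 1ℚ ℚ.* xₙ j ℚ.+ normalℚ Δ · xₙ)
    ≡⟨ solve 3 (λ a b D → con 1ℚ :* a :+ (con (ℚ.- 1ℚ) :* b :+ D) := (a :- b) :+ D) refl
         (xₙ i) (xₙ j) (normalℚ Δ · xₙ) ⟩
  (xₙ i ℚ.- xₙ j) ℚ.+ normalℚ Δ · xₙ
    ≡⟨ cong ((xₙ i ℚ.- xₙ j) ℚ.+_) (seq-∙ (normal Δ) x n) ⟨
  (xₙ i ℚ.- xₙ j) ℚ.+ seq (normal Δ ∙ x) n ∎
  where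
  open ≡-Reasoning
  open +-*-Solver
  xₙ : Vector ℚ _
  xₙ i = seq (x i) n

module _ {k} (x : Vector ℝ k) where

  open +-*-Solver

  normal∙≼0 : ∀ Δ → (∀ {i j} → Arc Δ i j → x i ≼ x j) → normal Δ ∙ x ≼ 0ℝ
  normal∙≼0 [] x≼ = ≼-pointwise (ℚ.≤-reflexive ∘ normal-[] x)
  normal∙≼0 ((i , j) ∷ Δ) x≼ =
    ≼-add (x≼ (here refl)) (normal∙≼0 Δ (x≼ ∘ there)) λ n →
      trans (cong (ℚ._- 0ℚ) (normal-∷ i j Δ x n))
        (solve 3 (λ a b D → ((a :- b) :+ D) :- con 0ℚ := (a :- b) :+ (D :- con 0ℚ)) refl
          (seq (x i) n) (seq (x j) n) (seq (normal Δ ∙ x) n))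

  0≼normal∙ : ∀ Δ → (∀ {i j} → Arc Δ i j → x j ≼ x i) → 0ℝ ≼ normal Δ ∙ x
  0≼normal∙ [] x≽ = ≼-pointwise (ℚ.≤-reflexive ∘ sym ∘ normal-[] x)
  0≼normal∙ ((i , j) ∷ Δ) x≽ =
    ≼-add (x≽ (here refl)) (0≼normal∙ Δ (x≽ ∘ there)) λ n →
      trans (cong (ℚ._-_ 0ℚ) (normal-∷ i j Δ x n))
        (solve 3 (λ a b D → con 0ℚ :- ((a :- b) :+ D) := (b :- a) :+ (con 0ℚ :- D)) refl
          (seq (x i) n) (seq (x j) n) (seq (normal Δ ∙ x) n))

  -- Nonpositive terms with a nonnegative sum all vanish: `normal∙≼0` bounds the terms after the
  -- chosen one, and the terms before it are discarded one at a time.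
  tight : ∀ Δ → (∀ {i j} → Arc Δ i j → x i ≼ x j) → 0ℝ ≼ normal Δ ∙ x →
          ∀ {i j} → Arc Δ i j → x j ≼ x i
  tight ((i , j) ∷ Δ) x≼ 0≼ (here refl) =
    ≼-add 0≼ (normal∙≼0 Δ (x≼ ∘ there)) λ n →
      trans (solve 3 (λ a b D → b :- a := (con 0ℚ :- ((a :- b) :+ D)) :+ (D :- con 0ℚ)) refl
              (seq (x i) n) (seq (x j) n) (seq (normal Δ ∙ x) n))
        (cong (λ t → (0ℚ ℚ.- t) ℚ.+ (seq (normal Δ ∙ x) n ℚ.- 0ℚ)) (sym (normal-∷ i j Δ x n)))
  tight ((i , j) ∷ Δ) x≼ 0≼ (there arc) = tight Δ (x≼ ∘ there) 0≼′ arc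
    where
    0≼′ : 0ℝ ≼ normal Δ ∙ x
    0≼′ = ≼-add 0≼ (x≼ (here refl)) λ n →
      trans (solve 3 (λ a b D → con 0ℚ :- D := (con 0ℚ :- ((a :- b) :+ D)) :+ (a :- b)) refl
              (seq (x i) n) (seq (x j) n) (seq (normal Δ ∙ x) n))
        (cong (λ t → (0ℚ ℚ.- t) ℚ.+ (seq (x i) n ℚ.- seq (x j) n)) (sym (normal-∷ i j Δ x n)))

-- Partitions and contractions

module _ {k} (E : Partition k) where

  partOf : Fin k → Fin (size E)
  partOf i = proj₁ (covers E i)

  ∈partOf : ∀ i → i Subset.∈ part E (partOf i)
  ∈partOf i = proj₁ (proj₂ (covers E i))

  ∈part⇒partOf≡ : ∀ {i p} → i Subset.∈ part E p → partOf i ≡ p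
  ∈part⇒partOf≡ {i} = proj₂ (proj₂ (covers E i))

  samePart⇒partOf≡ : ∀ {i j} → SamePart E i j → partOf i ≡ partOf j
  samePart⇒partOf≡ (p , i∈p , j∈p) = trans (∈part⇒partOf≡ i∈p) (sym (∈part⇒partOf≡ j∈p))

  partOf≡⇒samePart : ∀ {i j} → partOf i ≡ partOf j → SamePart E i j
  partOf≡⇒samePart {i} {j} eq =
    partOf i , ∈partOf i , subst (λ p → j Subset.∈ part E p) (sym eq) (∈partOf j)

  samePart? : Decidable (SamePart E)
  samePart? i j = map′ partOf≡⇒samePart samePart⇒partOf≡ (partOf i Fin.≟ partOf j)

module _ {k} (Γ : Digraph k) (E : Partition k) where

  arc? : Decidable (Arc Γ)
  arc? i j = (i , j) ∈ˡ? Γ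
    where open DecMembership (≡-dec Fin._≟_ Fin._≟_) renaming (_∈?_ to _∈ˡ?_)

  -- The union of the induced subgraphs of all parts, placed on `Fin k` so that `star?` decides its
  -- connectivity.
  InnerArc : Rel (Fin k) 0ℓ
  InnerArc i j = SamePart E i j × Arc Γ i j

  innerArc? : Decidable InnerArc
  innerArc? i j = samePart? E i j ×-dec arc? i j

  minorArc? : Decidable (MinorArc Γ E)
  minorArc? p q =
    ¬? (p Fin.≟ q) ×-dec
    Fin.any? λ i → Fin.any? λ j →
      (i ∈ˢ? part E p) ×-dec (j ∈ˢ? part E q) ×-dec arc? i j

  arc⇒star : ∀ {i j} → Arc Γ i j → Star (MinorArc Γ E) (partOf E i) (partOf E j)
  arc⇒star {i} {j} arc with partOf E i Fin.≟ partOf E j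
  ... | yes eq rewrite eq = ε
  ... | no neq            = (neq , i , j , ∈partOf E i , ∈partOf E j , arc) ◅ ε

  -- A walk along inner arcs cannot leave the part in which it starts: each arc lies in a single
  -- part, and by `covers` the part containing its first endpoint is unique.
  inner⇒induced : ∀ {p i j} → EqClosure InnerArc i j → ∀ i∈p j∈p →
                  EqClosure (InducedArc Γ (part E p)) (i , i∈p) (j , j∈p)
  inner⇒induced {p} ε i∈p j∈p =
    -- Vertices of the induced subgraph carry membership proofs; the two proofs for the final vertex
    -- agree by irrelevance.
    subst (λ h → EqClosure (InducedArc Γ (part E p)) (_ , i∈p) (_ , h))
      ([]=-irrelevant i∈p j∈p) ε
  inner⇒induced {p} {i} (step ◅ s) i∈p j∈p with step
  ... | fwd ((q , i∈q , w∈q) , arc)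
    with refl ← trans (sym (∈part⇒partOf≡ E i∈q)) (∈part⇒partOf≡ E i∈p)
    = fwd arc ◅ inner⇒induced s w∈q j∈p
  ... | bwd ((q , w∈q , i∈q) , arc)
    with refl ← trans (sym (∈part⇒partOf≡ E i∈q)) (∈part⇒partOf≡ E i∈p)
    = bwd arc ◅ inner⇒induced s w∈q j∈p

-- Faces of the braid cone

cone-≼ : ∀ {k} {Γ : Digraph k} {x} → x ∈ braidCone Γ → ∀ {i j} → Arc Γ i j → x i ≼ x j
cone-≼ x∈Q arc = ⌈ x∈Q arc ⌉

≼-cone : ∀ {k} {Γ : Digraph k} {x} → (∀ {i j} → Arc Γ i j → x i ≼ x j) → x ∈ braidCone Γ
≼-cone x≼ arc = ⌊ x≼ arc ⌋

walk⇒star : ∀ {V : Set} {R : Rel V 0ℓ} {l} (x : Vector V (suc l)) →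
            (∀ (i : Fin l) → R (x (inject₁ i)) (x (suc i))) → Star R (x zero) (x (fromℕ l))
walk⇒star {l = zero}  x s = ε
walk⇒star {l = suc l} x s = s zero ◅ walk⇒star (tail x) (s ∘ suc)

-- From a face to connected parts and an acyclic contraction

module FaceProperties
  {k} {Γ : Digraph k} {E : Partition k} {F : Pred (Vector ℝ k) 0ℓ}
  {c : Vector ℝ k} {δ : ℝ}
  (F-nonempty : Satisfiable F)
  (c∙x≤δ : ∀ x → x ∈ braidCone Γ → c ∙ x ≤ δ)
  (F≐ : F ≐ (λ x → x ∈ braidCone Γ × c ∙ x ≈ δ))
  (F-parts : IsEqualityPartition E F)
  where

  valid : ∀ {x} → (∀ {i j} → Arc Γ i j → x i ≼ x j) → c ∙ x ≼ δ
  valid {x} x≼ = ⌈ c∙x≤δ x (≼-cone {Γ = Γ} {x} x≼) ⌉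

  F⇒≼ : ∀ {x} → x ∈ F → ∀ {i j} → Arc Γ i j → x i ≼ x j
  F⇒≼ {x} x∈F = cone-≼ {Γ = Γ} {x} (proj₁ (proj₁ F≐ {x} x∈F))

  F⇒δ≼ : ∀ {x} → x ∈ F → δ ≼ c ∙ x
  F⇒δ≼ {x} x∈F = ≈⇒≽ {c ∙ x} {δ} (proj₂ (proj₁ F≐ {x} x∈F))

  ≼⇒F : ∀ {x} → (∀ {i j} → Arc Γ i j → x i ≼ x j) → δ ≼ c ∙ x → x ∈ F
  ≼⇒F {x} x≼ δ≼ = proj₂ F≐ {x} (≼-cone {Γ = Γ} {x} x≼ , ≼-antisym {c ∙ x} {δ} (valid {x} x≼) δ≼)

  samePart⇒≼ : ∀ {i j} → SamePart E i j → ∀ {x} → x ∈ F → x i ≼ x j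
  samePart⇒≼ {i} {j} same x∈F = ≈⇒≼ (Equivalence.to (F-parts i j) same _ x∈F)

  rep : Fin (size E) → Fin k
  rep p = proj₁ (nonempty E p)

  minorArc⇒≼ : ∀ {p q} → MinorArc Γ E p q → ∀ {x} → x ∈ F → x (rep p) ≼ x (rep q)
  minorArc⇒≼ {p} {q} (_ , i , j , i∈p , j∈q , arc) x∈F =
    ≼-trans (samePart⇒≼ (p , proj₂ (nonempty E p) , i∈p) x∈F)
      (≼-trans (F⇒≼ x∈F arc) (samePart⇒≼ (q , j∈q , proj₂ (nonempty E q)) x∈F))

  -- Along a cycle the values at the representatives increase weakly and return to their start.
  -- First and last representative then agree on all of `F`, so their parts coincide, whereas the
  -- closing arc joins distinct parts.
  acyclic : ¬ DirectedCycle (MinorArc Γ E)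
  acyclic record { l = l ; vertex = p ; step = step ; close = close } =
    proj₁ close (begin
      last                    ≡⟨ ∈part⇒partOf≡ E (proj₂ (nonempty E last)) ⟨
      partOf E (rep last)     ≡⟨ samePart⇒partOf≡ E same ⟩
      partOf E (rep (p zero)) ≡⟨ ∈part⇒partOf≡ E (proj₂ (nonempty E (p zero))) ⟩
      p zero                  ∎)
    where
    open ≡-Reasoning
    last = p (fromℕ l)
    same : SamePart E (rep last) (rep (p zero))
    same = Equivalence.from (F-parts (rep last) (rep (p zero))) λ x x∈F →
      ≼-antisym {x (rep last)} (minorArc⇒≼ close x∈F)
        (Star.fold (λ p q → x (rep p) ≼ x (rep q))
          (λ arc → ≼-trans (minorArc⇒≼ arc x∈F)) ≼-refl (walk⇒star p step))

  +ᵛ-closed : ∀ {x y} → x ∈ F → y ∈ F → x +ᵛ y ∈ F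
  +ᵛ-closed {x} {y} x∈F y∈F = ≼⇒F {x +ᵛ y}
    (λ {i} {j} arc → ≼-add (F⇒≼ x∈F arc) (F⇒≼ y∈F arc) λ n →
      solve 4 (λ a b c d → (a :+ b) :- (c :+ d) := (a :- c) :+ (b :- d)) refl
        (seq (x i) n) (seq (y i) n) (seq (x j) n) (seq (y j) n))
    (≼-trans δ≼δ+δ (≼-add (F⇒δ≼ x∈F) (F⇒δ≼ y∈F) λ n →
      trans (cong (λ s → (seq δ n ℚ.+ seq δ n) ℚ.- s) (∙-distribˡ-+ᵛ c x y n))
        (solve 3 (λ d a b → (d :+ d) :- (a :+ b) := (d :- a) :+ (d :- b)) refl
          (seq δ n) (seq (c ∙ x) n) (seq (c ∙ y) n))))
    where
    open +-*-Solver
    -- The functional is at least `δ + δ` on the sum, but `δ` is the bound required. The origin lies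
    -- in the cone, which makes `δ` nonnegative and closes the difference.
    0≼δ : c ∙ 0ᵛ ≼ δ
    0≼δ = valid {0ᵛ} (λ _ → ≼-refl)
    δ≼δ+δ : δ ≼ δ + δ
    δ≼δ+δ = ≼-add 0≼δ (≼-refl {0ℝ}) λ n →
      trans (solve 1 (λ d → d :- (d :+ d) := (con 0ℚ :- d) :+ (con 0ℚ :- con 0ℚ)) refl (seq δ n))
        (cong (λ z → (z ℚ.- seq δ n) ℚ.+ (0ℚ ℚ.- 0ℚ)) (sym (∙-zeroʳ c n)))

  -- Were no point of `F` strict on this arc, `¬gap⇒≼` would make the two coordinates equal
  -- throughout `F`, putting `i` and `j` in one part. The argument refutes absence, hence the double
  -- negation.
  gap : ∀ {i j} → Arc Γ i j → ¬ SamePart E i j →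
        ¬ ¬ (∃[ y ] y ∈ F × ∃[ η ] 0ℚ ℚ.< η × y i + const η ≼ y j)
  gap {i} {j} arc ¬same ¬gap = ¬same (Equivalence.from (F-parts i j) λ y y∈F →
    ≼-antisym {y i} (F⇒≼ y∈F arc) (¬gap⇒≼ λ (η , 0<η , le) → ¬gap (y , y∈F , η , 0<η , le)))

  Slack : Digraph k → Set
  Slack Δ = ∃[ x ] x ∈ F × ∃[ η ] 0ℚ ℚ.< η ×
            (∀ {i j} → Arc Δ i j → ¬ SamePart E i j → x i + const η ≼ x j)

  -- Witnesses from `gap` are added up arc by arc. A summand never destroys slack gained from
  -- another one, since every point of `F` is weakly increasing along arcs.
  slack : ∀ Δ → (∀ {i j} → Arc Δ i j → Arc Γ i j) → ¬ ¬ Slack Δ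
  slack [] _ none = none (_ , proj₂ F-nonempty , 1ℚ , ℚ.positive⁻¹ 1ℚ , λ ())
  slack ((i , j) ∷ Δ) Δ⊆Γ none = slack Δ (Δ⊆Γ ∘ there) λ (x , x∈F , η , 0<η , x-slack) →
    extend x x∈F η 0<η x-slack (samePart? E i j)
    where
    open +-*-Solver
    extend : ∀ x → x ∈ F → ∀ η → 0ℚ ℚ.< η →
             (∀ {i j} → Arc Δ i j → ¬ SamePart E i j → x i + const η ≼ x j) →
             ¬ Dec (SamePart E i j)
    extend x x∈F η 0<η x-slack (yes same) =
      none (x , x∈F , η , 0<η , λ
        { (here refl) ¬same → contradiction same ¬same
        ; (there arc)       → x-slack arc })
    extend x x∈F η 0<η x-slack (no ¬same) =
      gap (Δ⊆Γ (here refl)) ¬same λ (y , y∈F , θ , 0<θ , y-gap) →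
        -- On the new arc `y` supplies the slack `θ`, on the earlier ones `x` supplies `η`; the
        -- minimum serves for all of them.
        none (x +ᵛ y , +ᵛ-closed x∈F y∈F , η ℚ.⊓ θ , ⊓-pos 0<η 0<θ , λ
          { (here refl) _ →
              weaken ((x +ᵛ y) i) ((x +ᵛ y) j) (ℚ.p⊓q≤q η θ)
                y-gap (F⇒≼ x∈F (Δ⊆Γ (here refl))) λ n →
                solve 5 (λ a b t c d → (a :+ b :+ t) :- (c :+ d) := ((b :+ t) :- d) :+ (a :- c)) refl
                  (seq (x i) n) (seq (y i) n) θ (seq (x j) n) (seq (y j) n)
          ; {i′} {j′} (there arc) ¬same′ →
              weaken ((x +ᵛ y) i′) ((x +ᵛ y) j′) (ℚ.p⊓q≤p η θ)
                (x-slack arc ¬same′) (F⇒≼ y∈F (Δ⊆Γ (there arc))) λ n →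
                solve 5 (λ a b t c d → (a :+ b :+ t) :- (c :+ d) := ((a :+ t) :- c) :+ (b :- d)) refl
                  (seq (x i′) n) (seq (y i′) n) η (seq (x j′) n) (seq (y j′) n) })
      where
      ⊓-pos : ∀ {p q} → 0ℚ ℚ.< p → 0ℚ ℚ.< q → 0ℚ ℚ.< p ℚ.⊓ q
      ⊓-pos {p} {q} 0<p 0<q with ℚ.⊓-sel p q
      ... | inj₁ eq = subst (0ℚ ℚ.<_) (sym eq) 0<p
      ... | inj₂ eq = subst (0ℚ ℚ.<_) (sym eq) 0<q
      weaken : ∀ {p q a b a′ b′} u v → p ℚ.≤ q → a ≼ b → a′ ≼ b′ →
               (∀ n → (seq u n ℚ.+ q) ℚ.- seq v n ≡ (seq a n ℚ.- seq b n) ℚ.+ (seq a′ n ℚ.- seq b′ n)) →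
               u + const p ≼ v
      weaken {p} {q} u v p≤q a≼b a′≼b′ eq =
        ≼-trans {u + const p} {u + const q}
          (≼-pointwise (λ n → ℚ.+-monoʳ-≤ (seq u n) p≤q)) (≼-add a≼b a′≼b′ eq)

  -- c cannot increase along s, nor along t = - s, so it is constant along both.
  perturb : ∀ {x} → x ∈ F → ∀ {η} →
            (∀ {i j} → Arc Γ i j → ¬ SamePart E i j → x i + const η ≼ x j) →
            (s t : Vector ℚ k) → (∀ i → s i ℚ.+ t i ≡ 0ℚ) →
            (∀ {i j} → InnerArc Γ E i j → s i ≡ s j × t i ≡ t j) →
            (∀ i j → s i ℚ.≤ η ℚ.+ s j × t i ℚ.≤ η ℚ.+ t j) →
            x +ᵛ constᵛ s ∈ F
  perturb {x} x∈F {η} x-slack s t s+t≡0 inner outer =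
    -- The values at the two moved points add up to twice the value at `x`, hence to at least
    -- `δ + δ`. The one at `x +ᵛ constᵛ t` is at most `δ`, so the other is at least `δ`.
    ≼⇒F {x +ᵛ constᵛ s} x+s≼ (≼-add 2δ≼ x+t≼δ λ n → begin
      seq δ n ℚ.- X+S n
        ≡⟨ solve 3 (λ d p q → d :- p := ((d :+ d) :- (p :+ q)) :+ (q :- d)) refl
             (seq δ n) (X+S n) (X+T n) ⟩
      ((seq δ n ℚ.+ seq δ n) ℚ.- (X+S n ℚ.+ X+T n)) ℚ.+ (X+T n ℚ.- seq δ n)
        ≡⟨ cong (λ u → ((seq δ n ℚ.+ seq δ n) ℚ.- u) ℚ.+ (X+T n ℚ.- seq δ n)) (balance n) ⟩
      ((seq δ n ℚ.+ seq δ n) ℚ.- (X n ℚ.+ X n)) ℚ.+ (X+T n ℚ.- seq δ n) ∎)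
    where
    open ≡-Reasoning
    open +-*-Solver
    X X+S X+T : ℕ → ℚ
    X   = seq (c ∙ x)
    X+S = seq (c ∙ (x +ᵛ constᵛ s))
    X+T = seq (c ∙ (x +ᵛ constᵛ t))
    balance : ∀ n → X+S n ℚ.+ X+T n ≡ X n ℚ.+ X n
    balance n = ∙-balance c (x +ᵛ constᵛ s) (x +ᵛ constᵛ t) x x n λ i →
      trans (solve 3 (λ a s t → (a :+ s) :+ (a :+ t) := (a :+ a) :+ (s :+ t)) refl (seq (x i) n) (s i) (t i))
        (trans (cong ((seq (x i) n ℚ.+ seq (x i) n) ℚ.+_) (s+t≡0 i)) (ℚ.+-identityʳ _))
    2δ≼ : δ + δ ≼ c ∙ x + c ∙ x
    2δ≼ = ≼-add (F⇒δ≼ x∈F) (F⇒δ≼ x∈F) λ n →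
      solve 2 (λ d a → (d :+ d) :- (a :+ a) := (d :- a) :+ (d :- a)) refl (seq δ n) (X n)
    -- Inner arcs keep their inequality because both ends move equally; on the other arcs the slack
    -- `η` absorbs the relative movement.
    shift : ∀ s → (∀ {i j} → InnerArc Γ E i j → s i ≡ s j) → (∀ i j → s i ℚ.≤ η ℚ.+ s j) →
            ∀ {i j} → Arc Γ i j → (x +ᵛ constᵛ s) i ≼ (x +ᵛ constᵛ s) j
    shift s inner outer {i} {j} arc with samePart? E i j
    ... | yes same = ≼-add (F⇒≼ x∈F arc) (const-mono (ℚ.≤-reflexive (inner (same , arc)))) λ n →
      solve 4 (λ a s b t → (a :+ s) :- (b :+ t) := (a :- b) :+ (s :- t)) refl
        (seq (x i) n) (s i) (seq (x j) n) (s j)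
    ... | no ¬same = ≼-add (x-slack arc ¬same) (const-mono (outer i j)) λ n →
      solve 5 (λ a s b t e → (a :+ s) :- (b :+ t) := ((a :+ e) :- b) :+ (s :- (e :+ t))) refl
        (seq (x i) n) (s i) (seq (x j) n) (s j) η
    x+s≼ : ∀ {i j} → Arc Γ i j → (x +ᵛ constᵛ s) i ≼ (x +ᵛ constᵛ s) j
    x+s≼ = shift s (proj₁ ∘ inner) (λ i j → proj₁ (outer i j))
    x+t≼ : ∀ {i j} → Arc Γ i j → (x +ᵛ constᵛ t) i ≼ (x +ᵛ constᵛ t) j
    x+t≼ = shift t (proj₂ ∘ inner) (λ i j → proj₂ (outer i j))
    x+t≼δ : c ∙ (x +ᵛ constᵛ t) ≼ δ
    x+t≼δ = valid {x +ᵛ constᵛ t} x+t≼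

  -- Since connectivity is decidable, it suffices to refute its failure, and towards a contradiction
  -- the doubly negated `slack` may be used as if it were given.
  samePart⇒connected : ∀ {i j} → SamePart E i j → EqClosure (InnerArc Γ E) i j
  samePart⇒connected {u} {v} same = connected (component? v)
    where
    component? : ∀ w → Dec (EqClosure (InnerArc Γ E) u w)
    component? = star? (symClosure? (innerArc? Γ E)) u

    _when_ : ℚ → Bool → ℚ
    q when b = if b then q else 0ℚ

    when-balance : ∀ q b → q when b ℚ.+ (ℚ.- q) when b ≡ 0ℚ
    when-balance q true  = ℚ.+-inverseʳ q
    when-balance q false = ℚ.+-identityˡ 0ℚ

    component-inner : ∀ {i j} → InnerArc Γ E i j → does (component? i) ≡ does (component? j)
    component-inner {i} {j} arc =
      does-⇔ (mk⇔ (_◅◅ fwd arc ◅ ε) (_◅◅ bwd arc ◅ ε)) (component? i) (component? j)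

    -- All shifts of one sign lie in an interval of length `η`, with 0 as one end, so no two of them
    -- differ by more than `η`.
    outer : ∀ {η} → 0ℚ ℚ.≤ η → ∀ a b →
            η when a ℚ.≤ η ℚ.+ η when b × (ℚ.- η) when a ℚ.≤ η ℚ.+ (ℚ.- η) when b
    outer {η} 0≤η a b = up a b , down a b
      where
      open ℚ.≤-Reasoning
      0≤when : ∀ b → 0ℚ ℚ.≤ η when b
      0≤when true  = 0≤η
      0≤when false = ℚ.≤-refl
      when≤η : ∀ b → η when b ℚ.≤ η
      when≤η true  = ℚ.≤-refl
      when≤η false = 0≤η
      when≤0 : ∀ b → (ℚ.- η) when b ℚ.≤ 0ℚ
      when≤0 true  = ℚ.neg-antimono-≤ 0≤η
      when≤0 false = ℚ.≤-refl
      -η≤when : ∀ b → ℚ.- η ℚ.≤ (ℚ.- η) when b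
      -η≤when true  = ℚ.≤-refl
      -η≤when false = ℚ.neg-antimono-≤ 0≤η
      up : ∀ a b → η when a ℚ.≤ η ℚ.+ η when b
      up a b = begin
        η when a          ≤⟨ when≤η a ⟩
        η                 ≡⟨ ℚ.+-identityʳ η ⟨
        η ℚ.+ 0ℚ          ≤⟨ ℚ.+-monoʳ-≤ η (0≤when b) ⟩
        η ℚ.+ η when b    ∎
      down : ∀ a b → (ℚ.- η) when a ℚ.≤ η ℚ.+ (ℚ.- η) when b
      down a b = begin
        (ℚ.- η) when a           ≤⟨ when≤0 a ⟩
        0ℚ                       ≡⟨ ℚ.+-inverseʳ η ⟨
        η ℚ.- η                  ≤⟨ ℚ.+-monoʳ-≤ η (-η≤when b) ⟩
        η ℚ.+ (ℚ.- η) when b     ∎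

    separated : ¬ EqClosure (InnerArc Γ E) u v → ¬ Slack Γ
    separated ¬uv (x , x∈F , η , 0<η , x-slack) =
      -- The shift is `η` at `u` and 0 at `v`, outside the component. As `u` and `v` have equal
      -- coordinates both before and after the move, `η` would be at most 0.
      const-¬≼ 0<η (≼-add (samePart⇒≼ same x+s∈F) (samePart⇒≼ same⁻¹ x∈F) λ n →
        trans (solve 3 (λ e a b → e :- con 0ℚ := ((a :+ e) :- (b :+ con 0ℚ)) :+ (b :- a)) refl
                η (seq (x u) n) (seq (x v) n))
          (cong₂ (λ p q → ((seq (x u) n ℚ.+ p) ℚ.- (seq (x v) n ℚ.+ q)) ℚ.+ (seq (x v) n ℚ.- seq (x u) n))
            (cong (η when_) (sym (dec-true (component? u) ε)))
            (cong (η when_) (sym (dec-false (component? v) ¬uv)))))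
      where
      open +-*-Solver
      same⁻¹ : SamePart E v u
      same⁻¹ = proj₁ same , proj₂ (proj₂ same) , proj₁ (proj₂ same)
      s t : Vector ℚ k
      s w = η when does (component? w)
      t w = (ℚ.- η) when does (component? w)
      x+s∈F : x +ᵛ constᵛ s ∈ F
      x+s∈F = perturb x∈F x-slack s t
        (λ w → when-balance η (does (component? w)))
        (λ arc → cong (η when_) (component-inner arc) , cong ((ℚ.- η) when_) (component-inner arc))
        (λ i j → outer (ℚ.<⇒≤ 0<η) (does (component? i)) (does (component? j)))

    connected : Dec (EqClosure (InnerArc Γ E) u v) → EqClosure (InnerArc Γ E) u v
    connected (yes uv) = uv
    connected (no ¬uv) = ⊥-elim (slack Γ id (separated ¬uv))

  weaklyConnected : ∀ p → WeaklyConnected (InducedArc Γ (part E p))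
  weaklyConnected p (i , i∈p) (j , j∈p) =
    inner⇒induced Γ E (samePart⇒connected (p , i∈p , j∈p)) i∈p j∈p

-- From connected parts and an acyclic contraction to a face

module FaceConstruction
  {k} {Γ : Digraph k} {E : Partition k}
  (connected : ∀ p → WeaklyConnected (InducedArc Γ (part E p)))
  (acyclic : ¬ DirectedCycle (MinorArc Γ E))
  where

  innerArcs : Digraph k
  innerArcs = filter (uncurry (samePart? E)) Γ

  inner⁺ : ∀ {i j} → SamePart E i j → Arc Γ i j → Arc innerArcs i j
  inner⁺ same arc = ∈-filter⁺ (uncurry (samePart? E)) arc same

  inner⁻ : ∀ {i j} → Arc innerArcs i j → Arc Γ i j × SamePart E i j
  inner⁻ = ∈-filter⁻ (uncurry (samePart? E)) {xs = Γ}

  F : Pred (Vector ℝ k) 0ℓ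
  F x = x ∈ braidCone Γ × normal innerArcs ∙ x ≈ 0ℝ

  valid : ∀ {x} → x ∈ braidCone Γ → normal innerArcs ∙ x ≼ 0ℝ
  valid {x} x∈Q = normal∙≼0 x innerArcs (cone-≼ {Γ = Γ} {x} x∈Q ∘ proj₁ ∘ inner⁻)

  F⁺ : ∀ {x} → (∀ {i j} → Arc Γ i j → x i ≼ x j) →
       (∀ {i j} → SamePart E i j → x j ≼ x i) → x ∈ F
  F⁺ {x} x≼ x≽ =
    x∈Q , ≼-antisym {normal innerArcs ∙ x} {0ℝ} (valid {x} x∈Q)
      (0≼normal∙ x innerArcs (x≽ ∘ proj₂ ∘ inner⁻))
    where
    x∈Q : x ∈ braidCone Γ
    x∈Q = ≼-cone {Γ = Γ} {x} x≼

  isFace : IsFace (braidCone Γ) F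
  isFace =
    (0ᵛ , F⁺ {0ᵛ} (λ _ → ≼-refl) (λ _ → ≼-refl)) ,
    normal innerArcs , 0ℝ , (λ x x∈Q → ⌊ valid {x} x∈Q ⌋) , (id , id)

  -- By `tight`, a point of `F` has equal coordinates at the ends of every arc inside a part; weak
  -- connectivity spreads this equality over the part.
  samePart⇒≈ : ∀ {i j} → SamePart E i j → ∀ x → x ∈ F → x i ≈ x j
  samePart⇒≈ {i} {j} (p , i∈p , j∈p) x (x∈Q , c∙x≈0) = ≼-antisym {x i} (proj₁ i~j) (proj₂ i~j)
    where
    _~_ : Rel (∃[ i ] i Subset.∈ part E p) 0ℓ
    (i , _) ~ (j , _) = x i ≼ x j × x j ≼ x i
    ~-isEquivalence : IsEquivalence _~_
    ~-isEquivalence = record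
      { refl  = ≼-refl , ≼-refl
      ; sym   = λ (a , b) → b , a
      ; trans = λ (a , b) (c , d) → ≼-trans a c , ≼-trans d b
      }
    inner-~ : InducedArc Γ (part E p) ⇒ _~_
    inner-~ {i , i∈p} {j , j∈p} arc =
      cone-≼ {Γ = Γ} {x} x∈Q arc ,
      tight x innerArcs (cone-≼ {Γ = Γ} {x} x∈Q ∘ proj₁ ∘ inner⁻)
        (≈⇒≽ {normal innerArcs ∙ x} {0ℝ} c∙x≈0)
        (inner⁺ (p , i∈p , j∈p) arc)
    i~j : (i , i∈p) ~ (j , j∈p)
    i~j = EqClosure.fold ~-isEquivalence (λ {v} {w} → inner-~ {v} {w})
            (connected p (i , i∈p) (j , j∈p))

  reach? : Decidable (Star (MinorArc Γ E))
  reach? = star? (minorArc? Γ E)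

  -- The indicator of the vertices whose part is reachable from that of `i` increases along arcs and
  -- depends only on the part, so it lies in `F`. It is 1 at `i`, hence also at `j`.
  ≈⇒reach : ∀ {i j} → (∀ x → x ∈ F → x i ≈ x j) → Star (MinorArc Γ E) (partOf E i) (partOf E j)
  ≈⇒reach {i} {j} i≈j = reached (reach? p (partOf E j))
    where
    p = partOf E i
    1? : Bool → ℚ
    1? b = if b then 1ℚ else 0ℚ
    reached? : ∀ w → Dec (Star (MinorArc Γ E) p (partOf E w))
    reached? w = reach? p (partOf E w)
    x : Vector ℝ k
    x w = const (1? (does (reached? w)))

    1?-mono : ∀ {A B : Set} (a? : Dec A) (b? : Dec B) → (A → B) → 1? (does a?) ℚ.≤ 1? (does b?)
    1?-mono (yes _) (yes _) _ = ℚ.≤-refl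
    1?-mono (yes a) (no ¬b) f = contradiction (f a) ¬b
    1?-mono (no _)  (yes _) _ = ℚ.<⇒≤ (ℚ.positive⁻¹ 1ℚ)
    1?-mono (no _)  (no _)  _ = ℚ.≤-refl

    x-mono : ∀ {v w} → Star (MinorArc Γ E) (partOf E v) (partOf E w) → x v ≼ x w
    x-mono {v} {w} v↝w = const-mono (1?-mono (reached? v) (reached? w) (_◅◅ v↝w))

    x∈F : x ∈ F
    x∈F = F⁺ {x} (λ arc → x-mono (arc⇒star Γ E arc))
             (λ {v} {w} same → x-mono (subst (Star _ (partOf E w)) (sym (samePart⇒partOf≡ E same)) ε))

    reached : Dec (Star (MinorArc Γ E) p (partOf E j)) → Star (MinorArc Γ E) p (partOf E j)
    reached (yes p↝j) = p↝j
    reached (no p↛j)  = contradiction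
      (subst₂ (λ a b → const (1? a) ≼ const (1? b))
        (dec-true (reached? i) ε) (dec-false (reached? j) p↛j) (≈⇒≼ {x i} (i≈j x x∈F)))
      (const-¬≼ (ℚ.positive⁻¹ 1ℚ))

  -- Equality of coordinates is symmetric, so the two parts reach each other; if distinct, they
  -- would produce a directed cycle.
  ≈⇒samePart : ∀ {i j} → (∀ x → x ∈ F → x i ≈ x j) → SamePart E i j
  ≈⇒samePart {i} {j} i≈j = same (partOf E i Fin.≟ partOf E j)
    where
    j≈i : ∀ x → x ∈ F → x j ≈ x i
    j≈i x x∈F = ≼-antisym {x j} {x i} (≈⇒≽ {x i} {x j} (i≈j x x∈F)) (≈⇒≼ {x i} {x j} (i≈j x x∈F))
    i↝j : Star (MinorArc Γ E) (partOf E i) (partOf E j)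
    i↝j = ≈⇒reach {i} {j} i≈j
    j↝i : Star (MinorArc Γ E) (partOf E j) (partOf E i)
    j↝i = ≈⇒reach {j} {i} j≈i
    same : Dec (partOf E i ≡ partOf E j) → SamePart E i j
    same (yes i≡j) = partOf≡⇒samePart E i≡j
    same (no i≢j)  = contradiction (star⇒cycle Fin._≟_ i≢j i↝j j↝i) acyclic

  isEqualityPartition : IsEqualityPartition E F
  isEqualityPartition i j = mk⇔ samePart⇒≈ ≈⇒samePart

theorem11 : ∀ (k : ℕ) (Γ : Digraph k) (E : Partition k) →
    (∃[ F ] IsFace (braidCone Γ) F × IsEqualityPartition E F)
    ⇔
    ((∀ p → WeaklyConnected (InducedArc Γ (part E p))) × ¬ DirectedCycle (MinorArc Γ E))
theorem11 k Γ E = mk⇔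
  (λ (F , (F-nonempty , c , δ , valid , F≐) , F-parts) →
    let module F = FaceProperties {Γ = Γ} {E} {F} {c} {δ} F-nonempty valid F≐ F-parts
    in F.weaklyConnected , F.acyclic)
  (λ (connected , acyclic) →
    let open FaceConstruction {Γ = Γ} {E} connected acyclic
    in F , isFace , isEqualityPartition)
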